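{- Let $n\ge 2$. Then $$\mathrm{Min}(\Phi^+_{A_{n-1}})=\{0,\pm1\}\quad\text{and}\quad \mathrm{Min}(\Phi^+_{B_n})=\{0,\pm2^0,\pm2^1,\dots,\pm2^{\lfloor n/2\rfloor}\}.$$
   Context: Let $e_1,\dots,e_n$ be the standard basis of $\mathbb{R}^n$. $\Phi^+_{A_{n-1}}=\{e_i-e_j : 1\le i<j\le n\}$ and $\Phi^+_{B_n}=\{e_i\pm e_j: 1\le i<j\le n\}\cup\{e_i: i\in[n]\}$. For a finite set $U=\{u_1,\dots,u_m\}\subset\mathbb{R}^n$, $\mathsf{M}_U$ is the $m\times n$ matrix whose $i$-th row is $u_i$ (in some fixed order), and $\mathrm{Min}(U)$ is the set of all minors of $\mathsf{M}_U$, i.e. determinants of all square submatrices of all sizes.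
   Formalization: Minors are taken for arbitrary sequences of rows and columns (reordering and repetition allowed): with ordinary submatrices in a fixed row order the claim fails for n = 2 (0 is not a minor for A_1; only one of 2, -2 occurs for B_2). Vectors are over the integers, without loss. -}

module Defs where

open import Data.Bool.Base using (if_then_else_)
open import Data.Fin.Base using (Fin; zero; suc; toℕ; punchIn)
open import Data.Fin.Properties using (_≟_; _<?_)
open import Data.Integer.Base using (ℤ; _+_; _-_; _*_; _^_; -_; 0ℤ; 1ℤ; -1ℤ; +_)
open import Data.Integer.Properties using (+-*-semiring)
open import Data.List.Base
  using (List; _++_; map; filter; allFin; cartesianProduct; length; lookup)
open import Data.Nat.Base as ℕ using (ℕ; zero; suc)
open import Data.Product.Base using (_×_; _,_; ∃-syntax)
open import Data.Vec.Functional using (Vector; zipWith)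
open import Level using (0ℓ)
open import Relation.Binary.PropositionalEquality.Core using (_≡_)
open import Relation.Nullary.Decidable.Core using (does)
open import Relation.Unary using (Pred; _∪_; ｛_｝)

open import Algebra.Properties.Semiring.Sum +-*-semiring using (sum)

-- All root vectors involved have integer coordinates, so vectors and
-- determinants are taken over ℤ ⊂ ℝ.

Matrix : ℕ → ℕ → Set
Matrix m n = Fin m → Fin n → ℤ

submatrix : ∀ {m n k l} → Matrix m n → (Fin k → Fin m) → (Fin l → Fin n) → Matrix k l
submatrix M r c i j = M (r i) (c j)

-- Laplace expansion along the first row.
det : ∀ {n} → Matrix n n → ℤ
det {zero}  M = 1ℤ
det {suc n} M =
  sum λ j → -1ℤ ^ toℕ j * M zero j * det (submatrix M suc (punchIn j))

M[_] : ∀ {n} (U : List (Vector ℤ n)) → Matrix (length U) n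
M[ U ] = lookup U

-- A minor is det (M (r i) (c j)) for equally long, nonempty sequences r of row
-- indices and c of column indices.  Sequences need not be increasing, so
-- that Min does not depend on the order in which the rows are listed: with
-- increasing indices only one of 2 and -2 is a minor of the four rows of Φ⁺B 2.
-- Repeated indices are allowed too; a repetition makes the determinant vanish,
-- so this contributes at most the value 0.  For n ≥ 2 it matters only for
-- Φ⁺A 2, whose matrix is the single row (1 , -1): without repetition, 0 is not
-- a minor of it.
Min : ∀ {n} → List (Vector ℤ n) → Pred ℤ 0ℓ
Min U x =
  ∃[ k ] ∃[ r ] ∃[ c ] x ≡ det {suc k} (submatrix M[ U ] r c)

e : ∀ {n} → Fin n → Vector ℤ n
e i k = if does (i ≟ k) then 1ℤ else 0ℤ

_+ᵥ_ _-ᵥ_ : ∀ {n} → Vector ℤ n → Vector ℤ n → Vector ℤ n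
_+ᵥ_ = zipWith _+_
_-ᵥ_ = zipWith _-_

pairs : ∀ n → List (Fin n × Fin n)
pairs n = filter (λ (i , j) → i <? j) (cartesianProduct (allFin n) (allFin n))

-- Indexed by the ambient dimension: Φ⁺A n lists the positive roots of type Aₙ₋₁.
Φ⁺A Φ⁺B : ∀ n → List (Vector ℤ n)
Φ⁺A n = map (λ (i , j) → e i -ᵥ e j) (pairs n)
Φ⁺B n = map (λ (i , j) → e i -ᵥ e j) (pairs n)
     ++ map (λ (i , j) → e i +ᵥ e j) (pairs n)
     ++ map e (allFin n)

-- ±2^≤ b = {±2⁰, ±2¹, …, ±2ᵇ}
±2^≤ : ℕ → Pred ℤ 0ℓ
±2^≤ b x = ∃[ k ] k ℕ.≤ b × (｛ (+ 2) ^ k ｝ ∪ ｛ - ((+ 2) ^ k) ｝) x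

{-# OPTIONS --safe #-}
module Submission where

-- A minor with a repeated column vanishes.  Otherwise every row of the
-- submatrix is a sum of at most two vectors ± eᵢ, and we induct on its size.
-- If the first row is ± eᵢ, expand along it; if it is ± eᵢ ± eⱼ, clear its
-- entry j by adding ± column i to column j, and then expand.  This contracts
-- the edge ij of a signed graph: columns i and j merge, and the other rows
-- keep their shape, except that rows ± 2eⱼ can arise.  Giving each column the
-- number of original columns merged into it as its weight, such a row only
-- occurs at a column of weight ≥ 2, and expanding along it consumes that
-- weight; so at most ⌊ n /2⌋ factors 2 appear.  In type A the two signs of a
-- row are always opposite, no factor 2 appears, and the same induction runs
-- with all weights 0.  Powers of 2 are realised by block diagonal matrices
-- with blocks formed by the rows e₁ ± e₂.

open import Defs
open import Algebra.Bundles using (CommutativeMonoid)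
open import Data.Bool.Base using (if_then_else_)
open import Data.Fin.Base as Fin using (Fin; zero; suc; toℕ; punchIn; punchOut; inject₁)
open import Data.Fin.Properties
open import Data.Integer.Base as ℤ using (ℤ; _+_; _*_; _^_; -_; 0ℤ; 1ℤ; -1ℤ)
open import Data.Integer.Properties
  using (+-0-commutativeMonoid; +-*-semiring; +-identityˡ; +-identityʳ; *-zeroˡ; *-zeroʳ;
         *-identityˡ; *-identityʳ; *-assoc; -1*i≡-i)
open import Data.Integer.Tactic.RingSolver using (solve-∀)
open import Data.List.Base using (List; map; lookup; allFin; cartesianProduct)
open import Data.List.Membership.Propositional using (_∈_)
open import Data.List.Membership.Propositional.Properties
open import Data.List.Relation.Unary.Any using (index)
open import Data.List.Relation.Unary.Any.Properties using (lookup-index)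
open import Data.Maybe.Base using (Maybe; just; nothing)
open import Data.Nat.Base as ℕ using (ℕ; zero; suc; _≤_; ⌊_/2⌋)
import Data.Nat.Properties as ℕ
open import Data.Product.Base using (_×_; _,_; ∃; proj₁; proj₂)
open import Data.Sign.Base as Sign using (Sign)
import Data.Sign.Properties as Sign
open import Data.Sum.Base using (_⊎_; inj₁; inj₂; [_,_]′)
open import Data.Vec.Functional using (Vector; updateAt)
open import Data.Vec.Functional.Properties using (updateAt-updates; updateAt-minimal)
open import Function.Base using (_∘_; id; const; case_of_)
open import Relation.Binary.Definitions using (tri<; tri≈; tri>)
open import Relation.Binary.PropositionalEquality
  using (_≡_; _≢_; _≗_; refl; sym; trans; cong; cong₂; subst; module ≡-Reasoning)
open import Relation.Nullary using (yes; no; does; contradiction; ¬?; _×-dec_)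
open import Relation.Nullary.Decidable using (decidable-stable)
open import Relation.Unary using (_≐_; _⊆_; _∪_; ｛_｝)

open import Algebra.Properties.Semiring.Sum +-*-semiring
  using (sum-cong-≗; ∑-distrib-+; *-distribˡ-sum)
import Algebra.Properties.CommutativeMonoid.Sum ℕ.+-0-commutativeMonoid as Σℕ
open Σℕ using () renaming (sum to ∑ℕ)

-- Sums with at most two nonzero terms

module _ {a ℓ} (M : CommutativeMonoid a ℓ) where
  private
    module M = CommutativeMonoid M
    open import Algebra.Properties.CommutativeMonoid.Sum M as Σ using ()

  sum-zero : ∀ {n} {f : Vector M.Carrier n} → (∀ l → f l M.≈ M.ε) → Σ.sum f M.≈ M.ε
  sum-zero {n} f≈0 = M.trans (Σ.sum-cong-≋ f≈0) (Σ.sum-replicate-zero n)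

  sum-single : ∀ {n} (f : Vector M.Carrier n) i →
    (∀ l → l ≢ i → f l M.≈ M.ε) → Σ.sum f M.≈ f i
  sum-single {suc n} f i f≈0 = M.trans (Σ.sum-remove f)
    (M.trans (M.∙-congˡ (sum-zero λ l → f≈0 _ (punchInᵢ≢i i l))) (M.identityʳ _))

  sum-pair : ∀ {n} (f : Vector M.Carrier n) {i j} → i ≢ j →
    (∀ l → l ≢ i → l ≢ j → f l M.≈ M.ε) → Σ.sum f M.≈ f i M.∙ f j
  sum-pair {suc n} f {i} {j} i≢j f≈0 = M.trans (Σ.sum-remove f) (M.∙-congˡ
    (M.trans (sum-single (f ∘ punchIn i) (punchOut i≢j) off)
             (M.reflexive (cong f (punchIn-punchOut i≢j)))))
    where
    off : ∀ l → l ≢ punchOut i≢j → f (punchIn i l) M.≈ M.ε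
    off l l≢ = f≈0 _ (punchInᵢ≢i i l) λ eq →
      l≢ (punchIn-injective i _ _ (trans eq (sym (punchIn-punchOut i≢j))))

-- Determinants

minor : ∀ {n} → Matrix (suc n) (suc n) → Fin (suc n) → Matrix n n
minor M p = submatrix M suc (punchIn p)

cofactorTerm : ∀ {n} → Matrix (suc n) (suc n) → Fin (suc n) → ℤ
cofactorTerm M p = -1ℤ ^ toℕ p * M zero p * det (minor M p)

det-cong : ∀ {n} {M N : Matrix n n} → (∀ a → M a ≗ N a) → det M ≡ det N
det-cong {zero}  M≗N = refl
det-cong {suc n} M≗N = sum-cong-≗ λ p →
  cong₂ _*_ (cong (-1ℤ ^ toℕ p *_) (M≗N zero p)) (det-cong λ a l → M≗N (suc a) (punchIn p l))

cofactorTerm-zeroˡ : ∀ {n} (M : Matrix (suc n) (suc n)) p → M zero p ≡ 0ℤ → cofactorTerm M p ≡ 0ℤ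
cofactorTerm-zeroˡ M p eq rewrite eq =
  trans (cong (_* det (minor M p)) (*-zeroʳ (-1ℤ ^ toℕ p))) (*-zeroˡ (det (minor M p)))

cofactorTerm-zeroʳ : ∀ {n} (M : Matrix (suc n) (suc n)) p → det (minor M p) ≡ 0ℤ → cofactorTerm M p ≡ 0ℤ
cofactorTerm-zeroʳ M p eq = trans (cong (-1ℤ ^ toℕ p * M zero p *_) eq) (*-zeroʳ (-1ℤ ^ toℕ p * M zero p))

det-expand-single : ∀ {n} (M : Matrix (suc n) (suc n)) p →
  (∀ l → l ≢ p → M zero l ≡ 0ℤ) → det M ≡ cofactorTerm M p
det-expand-single M p off = sum-single +-0-commutativeMonoid (cofactorTerm M) p
  λ l l≢p → cofactorTerm-zeroˡ M l (off l l≢p)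

-- Removing a column other than two adjacent ones leaves them adjacent, so the induction in
-- `det-adjacent` passes to such minors.
punchIn-adjacent : ∀ {n} (p : Fin (2 ℕ.+ n)) (q : Fin (suc n)) → p ≢ inject₁ q → p ≢ suc q →
  ∃ λ q′ → punchIn p (inject₁ q′) ≡ inject₁ q × punchIn p (suc q′) ≡ suc q
punchIn-adjacent zero zero p≢q _ = contradiction refl p≢q
punchIn-adjacent zero (suc q) _ _ = q , refl , refl
punchIn-adjacent (suc zero) zero _ p≢q = contradiction refl p≢q
punchIn-adjacent {suc n} (suc (suc p)) zero _ _ = zero , refl , refl
punchIn-adjacent {suc n} (suc p) (suc q) p≢q p≢1+q
  with q′ , eq , eq′ ← punchIn-adjacent p q (p≢q ∘ cong suc) (p≢1+q ∘ cong suc)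
  = suc q′ , cong suc eq , cong suc eq′

-- Removing one or the other of two adjacent columns leaves the same columns, except that in one
-- common position the survivor of the pair differs.
punchIn-swap : ∀ {n} (q l : Fin n) → punchIn (inject₁ q) l ≡ punchIn (suc q) l
  ⊎ (punchIn (inject₁ q) l ≡ suc q × punchIn (suc q) l ≡ inject₁ q)
punchIn-swap zero zero = inj₂ (refl , refl)
punchIn-swap zero (suc l) = inj₁ refl
punchIn-swap (suc q) zero = inj₁ refl
punchIn-swap (suc q) (suc l) with punchIn-swap q l
... | inj₁ eq = inj₁ (cong suc eq)
... | inj₂ (eq , eq′) = inj₂ (cong suc eq , cong suc eq′)

-- In the expansion, minors that keep both equal columns vanish by induction. The two remaining
-- minors coincide and their cofactor signs are opposite.
det-adjacent : ∀ {n} (M : Matrix (suc n) (suc n)) (q : Fin n) →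
  (∀ a → M a (inject₁ q) ≡ M a (suc q)) → det M ≡ 0ℤ
det-adjacent {suc n} M q eq = trans
  (sum-pair +-0-commutativeMonoid (cofactorTerm M) {inject₁ q} {suc q} i≢s off)
  cancel
  where
  i≢s : inject₁ q ≢ suc q
  i≢s i≡s = ℕ.1+n≢n (sym (trans (sym (toℕ-inject₁ q)) (cong toℕ i≡s)))

  off : ∀ p → p ≢ inject₁ q → p ≢ suc q → cofactorTerm M p ≡ 0ℤ
  off p p≢q p≢1+q with q′ , eq₁ , eq₂ ← punchIn-adjacent p q p≢q p≢1+q =
    cofactorTerm-zeroʳ M p (det-adjacent (minor M p) q′ λ a →
      trans (cong (M (suc a)) eq₁) (trans (eq (suc a)) (cong (M (suc a)) (sym eq₂))))

  minors : ∀ a l → minor M (inject₁ q) a l ≡ minor M (suc q) a l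
  minors a l with punchIn-swap q l
  ... | inj₁ eq₁ = cong (M (suc a)) eq₁
  ... | inj₂ (eq₁ , eq₂) =
    trans (cong (M (suc a)) eq₁) (trans (sym (eq (suc a))) (cong (M (suc a)) (sym eq₂)))

  ring : ∀ s x d → s * x * d + -1ℤ * s * x * d ≡ 0ℤ
  ring = solve-∀

  cancel : cofactorTerm M (inject₁ q) + cofactorTerm M (suc q) ≡ 0ℤ
  cancel rewrite toℕ-inject₁ q | eq zero | det-cong {M = minor M (inject₁ q)} minors =
    ring (-1ℤ ^ toℕ q) (M zero (suc q)) (det (minor M (suc q)))

-- In the term of column `p` the minors of all three matrices agree and the entry is linear. In
-- every other term the entries agree and the minor is linear by induction.
det-linear : ∀ {n} (p : Fin n) c {M A B : Matrix n n} →
  (∀ a → M a p ≡ A a p + c * B a p) →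
  (∀ a l → l ≢ p → M a l ≡ A a l) → (∀ a l → l ≢ p → M a l ≡ B a l) →
  det M ≡ det A + c * det B
det-linear {suc n} p c {M} {A} {B} M-p M-A M-B =
  trans (sum-cong-≗ term) (trans (∑-distrib-+ (cofactorTerm A) (λ l → c * cofactorTerm B l))
    (cong (det A +_) (sym (*-distribˡ-sum c (cofactorTerm B)))))
  where
  ring₁ : ∀ c s x y d → s * (x + c * y) * d ≡ s * x * d + c * (s * y * d)
  ring₁ = solve-∀

  ring₂ : ∀ c s x d d′ → s * x * (d + c * d′) ≡ s * x * d + c * (s * x * d′)
  ring₂ = solve-∀

  off : ∀ {l} (l≢p : l ≢ p) {k} → k ≢ punchOut l≢p → punchIn l k ≢ p
  off {l} l≢p k≢ eq = k≢ (punchIn-injective l _ _ (trans eq (sym (punchIn-punchOut l≢p))))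

  term : ∀ l → cofactorTerm M l ≡ cofactorTerm A l + c * cofactorTerm B l
  term l with l ≟ p
  ... | yes refl
      rewrite M-p zero
            | sym (det-cong {M = minor M p} λ a k → M-A (suc a) _ (punchInᵢ≢i p k))
            | sym (det-cong {M = minor M p} λ a k → M-B (suc a) _ (punchInᵢ≢i p k))
      = ring₁ c (-1ℤ ^ toℕ p) (A zero p) (B zero p) (det (minor M p))
  ... | no l≢p
      rewrite sym (M-A zero l l≢p) | sym (M-B zero l l≢p)
            | det-linear (punchOut l≢p) c {minor M l} {minor A l} {minor B l}
                (λ a → subst (λ k → M (suc a) k ≡ A (suc a) k + c * B (suc a) k)
                  (sym (punchIn-punchOut l≢p)) (M-p (suc a)))
                (λ a k k≢ → M-A (suc a) _ (off l≢p k≢)) (λ a k k≢ → M-B (suc a) _ (off l≢p k≢))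
      = ring₂ c (-1ℤ ^ toℕ l) (M zero l) (det (minor A l)) (det (minor B l))

setColumn : ∀ {m n} → Matrix m n → Fin n → Vector ℤ m → Matrix m n
setColumn M p u a = updateAt (M a) p (const (u a))

setColumn-at : ∀ {m n} (M : Matrix m n) p u a → setColumn M p u a p ≡ u a
setColumn-at M p u a = updateAt-updates p (M a)

setColumn-off : ∀ {m n} (M : Matrix m n) p u a l → l ≢ p → setColumn M p u a l ≡ M a l
setColumn-off M p u a l = updateAt-minimal l p (M a)

det-setColumn-linear : ∀ {n} (M : Matrix n n) p c u v →
  det (setColumn M p λ a → u a + c * v a) ≡ det (setColumn M p u) + c * det (setColumn M p v)
det-setColumn-linear {n} M p c u v = det-linear p c
  (λ a → trans (setColumn-at M p w a)
    (sym (cong₂ (λ x y → x + c * y) (setColumn-at M p u a) (setColumn-at M p v a))))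
  (λ a l l≢p → trans (setColumn-off M p w a l l≢p) (sym (setColumn-off M p u a l l≢p)))
  (λ a l l≢p → trans (setColumn-off M p w a l l≢p) (sym (setColumn-off M p v a l l≢p)))
  where
  w : Vector ℤ n
  w a = u a + c * v a

-- Writing [u , v] for det M with u and v as columns j and j + 1, where column
-- i equals y: [x , y] = [x + y , y] = [x + y , x + y] - [x + y , x] = 0, using
-- [y , v] = 0 (columns i and j agree) and [u , u] = 0.
det-equal-columns-step : ∀ {n} (i : Fin (suc n)) (j : Fin n) → i ≢ inject₁ j → i ≢ suc j →
  (∀ (N : Matrix (suc n) (suc n)) → (∀ a → N a i ≡ N a (inject₁ j)) → det N ≡ 0ℤ) →
  (M : Matrix (suc n) (suc n)) → (∀ a → M a i ≡ M a (suc j)) → det M ≡ 0ℤ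
det-equal-columns-step {n} i j i≢p i≢r vanish M eq = begin
  det M             ≡⟨ det-cong M≗ ⟩
  D x y             ≡⟨ drop (D x y) ⟨
  D x y + 1ℤ * 0ℤ   ≡⟨ cong (λ z → D x y + 1ℤ * z) (D-y y) ⟨
  D x y + 1ℤ * D y y ≡⟨ linearˡ x y y ⟨
  D x+y y           ≡⟨ D-x+y,y ⟩
  0ℤ                ∎
  where
  open ≡-Reasoning
  p r : Fin (suc n)
  p = inject₁ j
  r = suc j

  x y x+y : Vector ℤ (suc n)
  x a = M a p
  y a = M a r
  x+y a = x a + 1ℤ * y a

  N : Vector ℤ (suc n) → Vector ℤ (suc n) → Matrix (suc n) (suc n)
  N u v = setColumn (setColumn M r v) p u

  D : Vector ℤ (suc n) → Vector ℤ (suc n) → ℤ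
  D u v = det (N u v)

  p≢r : p ≢ r
  p≢r p≡r = ℕ.1+n≢n (sym (trans (sym (toℕ-inject₁ j)) (cong toℕ p≡r)))

  N-p : ∀ u v a → N u v a p ≡ u a
  N-p u v = setColumn-at (setColumn M r v) p u

  N-r : ∀ u v a → N u v a r ≡ v a
  N-r u v a = trans (setColumn-off (setColumn M r v) p u a r (p≢r ∘ sym)) (setColumn-at M r v a)

  N-off : ∀ u v a l → l ≢ p → l ≢ r → N u v a l ≡ M a l
  N-off u v a l l≢p l≢r = trans (setColumn-off (setColumn M r v) p u a l l≢p) (setColumn-off M r v a l l≢r)

  M≗ : ∀ a → M a ≗ N x y a
  M≗ a l with l ≟ p | l ≟ r
  ... | yes refl | _ = sym (N-p x y a)
  ... | no _ | yes refl = sym (N-r x y a)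
  ... | no l≢p | no l≢r = sym (N-off x y a l l≢p l≢r)

  linearˡ : ∀ u u′ v → D (λ a → u a + 1ℤ * u′ a) v ≡ D u v + 1ℤ * D u′ v
  linearˡ u u′ v = det-setColumn-linear (setColumn M r v) p 1ℤ u u′

  linearʳ : ∀ u v v′ → D u (λ a → v a + 1ℤ * v′ a) ≡ D u v + 1ℤ * D u v′
  linearʳ u v v′ = det-linear r 1ℤ
    (λ a → trans (N-r u w a) (sym (cong₂ (λ s t → s + 1ℤ * t) (N-r u v a) (N-r u v′ a))))
    (λ a l → off a l v) (λ a l → off a l v′)
    where
    w : Vector ℤ (suc n)
    w a = v a + 1ℤ * v′ a
    off : ∀ a l v → l ≢ r → N u w a l ≡ N u v a l
    off a l v l≢r with l ≟ p
    ... | yes refl = trans (N-p u w a) (sym (N-p u v a))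
    ... | no l≢p = trans (N-off u w a l l≢p l≢r) (sym (N-off u v a l l≢p l≢r))

  D-y : ∀ v → D y v ≡ 0ℤ
  D-y v = vanish (N y v) λ a → trans (N-off y v a i i≢p i≢r) (trans (eq a) (sym (N-p y v a)))

  D-diagonal : ∀ u → D u u ≡ 0ℤ
  D-diagonal u = det-adjacent (N u u) j λ a → trans (N-p u u a) (sym (N-r u u a))

  drop : ∀ z → z + 1ℤ * 0ℤ ≡ z
  drop = solve-∀

  D-x+y,x : D x+y x ≡ 0ℤ
  D-x+y,x = trans (linearˡ x y x) (cong₂ (λ s t → s + 1ℤ * t) (D-diagonal x) (D-y x))

  D-x+y,y : D x+y y ≡ 0ℤ
  D-x+y,y = begin
    D x+y y                 ≡⟨ ring (D x+y y) ⟩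
    0ℤ + 1ℤ * D x+y y       ≡⟨ cong (_+ 1ℤ * D x+y y) D-x+y,x ⟨
    D x+y x + 1ℤ * D x+y y  ≡⟨ linearʳ x+y x y ⟨
    D x+y x+y               ≡⟨ D-diagonal x+y ⟩
    0ℤ                      ∎
    where
    ring : ∀ z → z ≡ 0ℤ + 1ℤ * z
    ring = solve-∀

-- Moves the right-hand column leftwards until the equal columns are adjacent. The recursion is on
-- `d`, because `inject₁ j` is not structurally smaller than `suc j`.
det-equal-columns-≤ : ∀ d {n} (i : Fin (suc n)) (j : Fin n) → toℕ j ≡ d → toℕ i ≤ d →
  (M : Matrix (suc n) (suc n)) → (∀ a → M a i ≡ M a (suc j)) → det M ≡ 0ℤ
det-equal-columns-≤ d i j j≡d i≤d M eq with i ≟ inject₁ j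
... | yes refl = det-adjacent M j eq
det-equal-columns-≤ zero zero zero j≡d i≤d M eq | no i≢p = contradiction refl i≢p
det-equal-columns-≤ (suc d) i (suc j) j≡d i≤d M eq | no i≢p =
  -- `inject₁ (suc j)` is definitionally `suc (inject₁ j)`, so the claim for `d` is exactly the
  -- required `vanish`.
  det-equal-columns-step i (suc j) i≢p i≢r
    (det-equal-columns-≤ d i (inject₁ j) (trans (toℕ-inject₁ j) (ℕ.suc-injective j≡d)) (ℕ.≤-pred i<1+d))
    M eq
  where
  i<1+d : toℕ i ℕ.< suc d
  i<1+d = ℕ.≤∧≢⇒< i≤d λ i≡1+d → i≢p (toℕ-injective
    (trans i≡1+d (trans (sym j≡d) (sym (toℕ-inject₁ (suc j))))))
  i≢r : i ≢ suc (suc j)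
  i≢r refl = ℕ.<⇒≱ i<1+d (ℕ.≤-trans (ℕ.≤-reflexive (sym j≡d)) (ℕ.n≤1+n _))

det-equal-columns : ∀ {n} (M : Matrix n n) {i j} → i ≢ j → (∀ a → M a i ≡ M a j) → det M ≡ 0ℤ
det-equal-columns M {i} {j} i≢j eq with ℕ.<-cmp (toℕ i) (toℕ j)
det-equal-columns M {i} {suc j} i≢j eq | tri< i<j _ _ =
  det-equal-columns-≤ (toℕ j) i j refl (ℕ.≤-pred i<j) M eq
... | tri≈ _ i≡j _ = contradiction (toℕ-injective i≡j) i≢j
det-equal-columns M {suc i} {j} i≢j eq | tri> _ _ i>j =
  det-equal-columns-≤ (toℕ i) j i refl (ℕ.≤-pred i>j) M (sym ∘ eq)

e-at : ∀ {n} (i : Fin n) → e i i ≡ 1ℤ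
e-at i with i ≟ i
... | yes _ = refl
... | no i≢i = contradiction refl i≢i

e-off : ∀ {n} {i l : Fin n} → i ≢ l → e i l ≡ 0ℤ
e-off {i = i} {l} i≢l with i ≟ l
... | yes i≡l = contradiction i≡l i≢l
... | no _ = refl

-- The factor `e j l` confines the change to column `j`. By linearity the determinant changes by `c`
-- times one whose columns `i` and `j` agree.
det-column-op : ∀ {n} (M : Matrix n n) c {i j} → i ≢ j →
  det (λ a l → M a l + c * (e j l * M a i)) ≡ det M
det-column-op {n} M c {i} {j} i≢j = begin
  det M′                     ≡⟨ det-linear j c at (λ a l → off a l) off′ ⟩
  det M + c * det N          ≡⟨ cong (λ z → det M + c * z) N≡0 ⟩
  det M + c * 0ℤ             ≡⟨ ring c (det M) ⟩
  det M                      ∎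
  where
  open ≡-Reasoning
  mᵢ : Vector ℤ n
  M′ N : Matrix n n
  M′ a l = M a l + c * (e j l * M a i)
  mᵢ = λ a → M a i
  N = setColumn M j mᵢ

  ring : ∀ c z → z + c * 0ℤ ≡ z
  ring = solve-∀

  N≡0 : det N ≡ 0ℤ
  N≡0 = det-equal-columns N i≢j λ a →
    trans (setColumn-off M j mᵢ a i i≢j) (sym (setColumn-at M j mᵢ a))

  at : ∀ a → M′ a j ≡ M a j + c * N a j
  at a = cong (λ z → M a j + c * z) (trans (cong (_* M a i) (e-at j))
    (trans (*-identityˡ (M a i)) (sym (setColumn-at M j mᵢ a))))

  off : ∀ a l → l ≢ j → M′ a l ≡ M a l
  off a l l≢j rewrite e-off (l≢j ∘ sym) = trans (cong (λ z → M a l + c * z) (*-zeroˡ (M a i))) (ring c (M a l))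

  off′ : ∀ a l → l ≢ j → M′ a l ≡ N a l
  off′ a l l≢j = trans (off a l l≢j) (sym (setColumn-off M j mᵢ a l l≢j))

-- Values of the form 0, ±2ᵏ

-- `N` stands for the total weight of the columns; halving it makes each factor 2 cost weight 2.
Value : ℕ → ℤ → Set
Value N = ｛ 0ℤ ｝ ∪ ±2^≤ ⌊ N /2⌋

value-one : ∀ N → Value N 1ℤ
value-one N = inj₂ (0 , ℕ.z≤n , inj₁ refl)

value-mono : ∀ {M N z} → M ≤ N → Value M z → Value N z
value-mono M≤N (inj₁ z≡0) = inj₁ z≡0
value-mono M≤N (inj₂ (k , k≤ , z≡)) = inj₂ (k , ℕ.≤-trans k≤ (ℕ.⌊n/2⌋-mono M≤N) , z≡)

value-neg : ∀ {N} z → Value N z → Value N (-1ℤ * z)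
value-neg z (inj₁ refl) = inj₁ refl
value-neg z (inj₂ (k , k≤ , inj₁ refl)) = inj₂ (k , k≤ , inj₂ (ring ((ℤ.+ 2) ^ k)))
  where
  ring : ∀ z → - z ≡ -1ℤ * z
  ring = solve-∀
value-neg z (inj₂ (k , k≤ , inj₂ refl)) = inj₂ (k , k≤ , inj₁ (ring ((ℤ.+ 2) ^ k)))
  where
  ring : ∀ z → z ≡ -1ℤ * - z
  ring = solve-∀

value-double : ∀ {N} z → Value N z → Value (2 ℕ.+ N) ((ℤ.+ 2) * z)
value-double z (inj₁ refl) = inj₁ refl
value-double z (inj₂ (k , k≤ , inj₁ refl)) = inj₂ (suc k , ℕ.s≤s k≤ , inj₁ refl)
value-double z (inj₂ (k , k≤ , inj₂ refl)) = inj₂ (suc k , ℕ.s≤s k≤ , inj₂ (ring ((ℤ.+ 2) ^ k)))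
  where
  ring : ∀ z → - ((ℤ.+ 2) * z) ≡ (ℤ.+ 2) * - z
  ring = solve-∀

value-power : ∀ {N} k z → Value N z → Value N (-1ℤ ^ k * z)
value-power {N} zero z v = subst (Value N) (sym (*-identityˡ z)) v
value-power {N} (suc k) z v = subst (Value N) (ring (-1ℤ ^ k) z) (value-neg (-1ℤ ^ k * z) (value-power k z v))
  where
  ring : ∀ s z → -1ℤ * (s * z) ≡ -1ℤ * s * z
  ring = solve-∀

σ : Sign → ℤ
σ Sign.+ = 1ℤ
σ Sign.- = -1ℤ

σ-* : ∀ s t → σ (s Sign.* t) ≡ σ s * σ t
σ-* Sign.+ Sign.+ = refl
σ-* Sign.+ Sign.- = refl
σ-* Sign.- Sign.+ = refl
σ-* Sign.- Sign.- = refl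

value-sign : ∀ {N} s z → Value N z → Value N (σ s * z)
value-sign {N} Sign.+ z v = subst (Value N) (sym (*-identityˡ z)) v
value-sign Sign.- z v = value-neg z v

-- Weighted rows

-- just (s , i) stands for ± eᵢ, and nothing for the zero vector.
Term : ℕ → Set
Term n = Maybe (Sign × Fin n)

⟦_⟧ : ∀ {n} → Term n → Vector ℤ n
⟦ nothing ⟧ l = 0ℤ
⟦ just (s , i) ⟧ l = σ s * e i l

infixr 7 _·_
_·_ : ∀ {n} → Sign → Term n → Term n
s · nothing = nothing
s · just (t , i) = just (s Sign.* t , i)

⟦·⟧ : ∀ {n} s (x : Term n) l → ⟦ s · x ⟧ l ≡ σ s * ⟦ x ⟧ l
⟦·⟧ s nothing l = sym (*-zeroʳ (σ s))
⟦·⟧ s (just (t , i)) l = trans (cong (_* e i l) (σ-* s t)) (*-assoc (σ s) (σ t) (e i l))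

Weight : ℕ → Set
Weight n = Vector ℕ n

Positive : ∀ {n} → Weight n → Set
Positive w = ∀ l → 1 ≤ w l

-- The shared `s` restricts the condition to terms of equal sign; opposite signs are allowed for
-- every weight. The bound `2 ≤ w i` concerns rows ± 2eᵢ.
Compatible : ∀ {n} → Weight n → Term n → Term n → Set
Compatible w x y = ∀ {s i j} → x ≡ just (s , i) → y ≡ just (s , j) → Positive w × (i ≡ j → 2 ≤ w i)

-- The weight of a column counts the original columns merged into it (or is
-- constantly zero, in which case two equal signs never occur in a row).
record Row {n} (w : Weight n) (v : Vector ℤ n) : Set where
  constructor row
  field
    x y        : Term n
    v≗         : v ≗ ⟦ x ⟧ +ᵥ ⟦ y ⟧
    compatible : Compatible w x y

-- A linear map on rows that sends each basis vector to a signed basis vector or zero. The last four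
-- fields are what preserves `Compatible`: a sign flip, which can make opposite signs equal, needs
-- positive weights (`neg`); weights do not drop (`single`); and they add up when columns meet
-- (`pair`).
record Transport {m n} (w : Weight m) (w′ : Weight n) (T : Vector ℤ m → Vector ℤ n) : Set where
  field
    T-cong : ∀ {u v} → u ≗ v → T u ≗ T v
    T-+    : ∀ u v → T (u +ᵥ v) ≗ T u +ᵥ T v
    T-*    : ∀ c v l → T (λ k → c * v k) l ≡ c * T v l
    φ      : Fin m → Term n
    T-e    : ∀ i → T (e i) ≗ ⟦ φ i ⟧
    pos    : Positive w → Positive w′
    neg    : ∀ {i k} → φ i ≡ just (Sign.- , k) → Positive w
    single : ∀ {i s k} → φ i ≡ just (s , k) → w i ≤ w′ k
    pair   : ∀ {i j s t k} → i ≢ j → φ i ≡ just (s , k) → φ j ≡ just (t , k) → w i ℕ.+ w j ≤ w′ k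

module _ {m n} {w : Weight m} {w′ : Weight n} {T : Vector ℤ m → Vector ℤ n}
         (transport : Transport w w′ T) where
  open Transport transport

  mapTerm : Term m → Term n
  mapTerm nothing = nothing
  mapTerm (just (s , i)) = s · φ i

  T-term : ∀ x → T ⟦ x ⟧ ≗ ⟦ mapTerm x ⟧
  T-term nothing l = T-* 0ℤ ⟦ nothing ⟧ l
  T-term (just (s , i)) l = trans (T-* (σ s) (e i) l)
    (trans (cong (σ s *_) (T-e i l)) (sym (⟦·⟧ s (φ i) l)))

  ·-just : ∀ s (x : Term n) {u k} → s · x ≡ just (u , k) → ∃ λ a → x ≡ just (a , k) × s Sign.* a ≡ u
  ·-just s (just (a , k)) refl = a , refl , refl

  -- If the images have equal signs, then either `φ` flipped a sign or the signs were equal before;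
  -- both give positive weights. Distinct columns that meet yield weight at least 1 + 1, while a
  -- column occurring twice already had weight at least 2.
  mapTerm-compatible : ∀ x y → Compatible w x y → Compatible w′ (mapTerm x) (mapTerm y)
  mapTerm-compatible nothing y comp ()
  mapTerm-compatible (just (s , i)) nothing comp eq ()
  mapTerm-compatible (just (s , i)) (just (t , j)) comp eq eq′
    with a , φi , sa≡u ← ·-just s (φ i) eq | b , φj , tb≡u ← ·-just t (φ j) eq′
    = pos w>0 , λ { refl → bound φi φj }
    where
    equal-signs : a ≡ b → s ≡ t
    equal-signs refl = Sign.*-cancelʳ-≡ a s t (trans sa≡u (sym tb≡u))

    heavy : s ≡ t → Positive w × (i ≡ j → 2 ≤ w i)
    heavy refl = comp refl refl

    positive : ∀ a b → φ i ≡ just (a , _) → φ j ≡ just (b , _) → (a ≡ b → s ≡ t) → Positive w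
    positive Sign.- _ φi _ _ = neg φi
    positive Sign.+ Sign.- _ φj _ = neg φj
    positive Sign.+ Sign.+ _ _ eq = proj₁ (heavy (eq refl))

    w>0 : Positive w
    w>0 = positive a b φi φj equal-signs

    bound : ∀ {k} → φ i ≡ just (a , k) → φ j ≡ just (b , k) → 2 ≤ w′ k
    bound φi φj with i ≟ j
    ... | no i≢j = ℕ.≤-trans (ℕ.+-mono-≤ (w>0 i) (w>0 j)) (pair i≢j φi φj)
    ... | yes refl = ℕ.≤-trans (proj₂ (heavy (equal-signs a≡b)) refl) (single φi)
      where
      a≡b : a ≡ b
      a≡b = case trans (sym φi) φj of λ { refl → refl }

  transport-row : ∀ {v} → Row w v → Row w′ (T v)
  transport-row (row x y v≗ comp) = row (mapTerm x) (mapTerm y)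
    (λ l → trans (T-cong v≗ l) (trans (T-+ ⟦ x ⟧ ⟦ y ⟧ l) (cong₂ _+_ (T-term x l) (T-term y l))))
    (mapTerm-compatible x y comp)

-- Restricting, deleting and merging columns

e-injective : ∀ {m n} {f : Fin m → Fin n} → (∀ {i j} → f i ≡ f j → i ≡ j) →
  ∀ i j → e (f i) (f j) ≡ e i j
e-injective {f = f} f-inj i j with i ≟ j
... | yes refl = e-at (f i)
... | no i≢j = e-off (i≢j ∘ f-inj)

-- Columns not chosen by `c` go to zero; by injectivity no two columns meet and no sign changes.
restrict-transport : ∀ {m n} (c : Fin n → Fin m) → (∀ {i j} → c i ≡ c j → i ≡ j) →
  ∀ q → Transport (const q) (const q) (_∘ c)
restrict-transport {m} {n} c c-inj q = record
  { T-cong = λ u≗v l → u≗v (c l)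
  ; T-+    = λ _ _ _ → refl
  ; T-*    = λ _ _ _ → refl
  ; φ      = φ
  ; T-e    = T-e
  ; pos    = λ q>0 l → q>0 (c l)
  ; neg    = λ φi → case proj₁ (inv φi) of λ ()
  ; single = λ _ → ℕ.≤-refl
  ; pair   = λ i≢j φi φj → contradiction (trans (sym (proj₂ (inv φi))) (proj₂ (inv φj))) i≢j
  }
  where
  φ : Fin m → Term n
  φ i with any? (λ b → c b ≟ i)
  ... | yes (b , _) = just (Sign.+ , b)
  ... | no _ = nothing

  inv : ∀ {i s b} → φ i ≡ just (s , b) → s ≡ Sign.+ × c b ≡ i
  inv {i} eq with any? (λ b → c b ≟ i)
  inv refl | yes (b , cb≡i) = refl , cb≡i

  T-e : ∀ i l → e i (c l) ≡ ⟦ φ i ⟧ l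
  T-e i l with any? (λ b → c b ≟ i)
  ... | yes (b , refl) = trans (e-injective c-inj b l) (sym (*-identityˡ (e b l)))
  ... | no ∄b = e-off λ i≡cl → ∄b (l , sym i≡cl)

-- The image of `e k` when column `i` is removed, where `z` is the image of `e i` itself: `nothing`
-- for a deletion, a signed basis vector for a merge.
removeTerm : ∀ {n} → Fin (suc n) → Term n → Fin (suc n) → Term n
removeTerm i z k with i ≟ k
... | yes _ = z
... | no i≢k = just (Sign.+ , punchOut i≢k)

removeTerm-inv : ∀ {n} i (z : Term n) {k s l} → removeTerm i z k ≡ just (s , l) →
  (s ≡ Sign.+ × k ≡ punchIn i l) ⊎ (k ≡ i × z ≡ just (s , l))
removeTerm-inv i z {k} eq with i ≟ k
... | yes refl = inj₂ (refl , eq)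
removeTerm-inv i z refl | no i≢k = inj₁ (refl , sym (punchIn-punchOut i≢k))

e-punch : ∀ {n} {i k : Fin (suc n)} (i≢k : i ≢ k) l → e k (punchIn i l) ≡ e (punchOut i≢k) l
e-punch {i = i} {k} i≢k l = trans (cong (λ k → e k (punchIn i l)) (sym (punchIn-punchOut i≢k)))
  (e-injective (punchIn-injective i _ _) (punchOut i≢k) l)

delete-transport : ∀ {n} (w : Weight (suc n)) i → Transport w (w ∘ punchIn i) (_∘ punchIn i)
delete-transport {n} w i = record
  { T-cong = λ u≗v l → u≗v (punchIn i l)
  ; T-+    = λ _ _ _ → refl
  ; T-*    = λ _ _ _ → refl
  ; φ      = removeTerm i nothing
  ; T-e    = T-e
  ; pos    = λ w>0 l → w>0 (punchIn i l)
  ; neg    = λ φi → case proj₁ (inv φi) of λ ()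
  ; single = λ φi → ℕ.≤-reflexive (cong w (proj₂ (inv φi)))
  ; pair   = λ i≢j φi φj → contradiction (trans (proj₂ (inv φi)) (sym (proj₂ (inv φj)))) i≢j
  }
  where
  inv : ∀ {k s l} → removeTerm i nothing k ≡ just (s , l) → s ≡ Sign.+ × k ≡ punchIn i l
  inv φk with inj₁ eqs ← removeTerm-inv i nothing φk = eqs

  T-e : ∀ k l → e k (punchIn i l) ≡ ⟦ removeTerm i nothing k ⟧ l
  T-e k l with i ≟ k
  ... | yes refl = e-off (punchInᵢ≢i i l ∘ sym)
  ... | no i≢k = trans (e-punch i≢k l) (sym (*-identityˡ _))

mergedWeight : ∀ {n} → Weight (suc n) → Fin (suc n) → Fin n → Weight n
mergedWeight w i j l = w (punchIn i l) ℕ.+ (if does (j ≟ l) then w i else 0)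

-- The column operation of `det-column-op` followed by deletion of column `i`. It sends `e i` to
-- `σ c` times the basis vector of column `j`, so signs flip only when `c` is `Sign.-`.
merge-transport : ∀ {n} (w : Weight (suc n)) c {i j} (i≢j : i ≢ j) → (c ≡ Sign.- → Positive w) →
  Transport w (mergedWeight w i (punchOut i≢j))
    (λ v l → v (punchIn i l) + σ c * (e j (punchIn i l) * v i))
merge-transport {n} w c {i} {j} i≢j w>0 = record
  { T-cong = λ u≗v l → cong₂ (λ x y → x + σ c * (e j (punchIn i l) * y)) (u≗v (punchIn i l)) (u≗v i)
  ; T-+    = λ u v l → ring₁ (u (punchIn i l)) (v (punchIn i l)) (σ c) (e j (punchIn i l)) (u i) (v i)
  ; T-*    = λ d v l → ring₂ d (v (punchIn i l)) (σ c) (e j (punchIn i l)) (v i)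
  ; φ      = φ
  ; T-e    = T-e
  ; pos    = λ pos l → ℕ.≤-trans (pos (punchIn i l)) (light l)
  ; neg    = λ φk → [ (λ { (() , _) }) , (λ { (_ , refl) → w>0 refl }) ]′ (inv φk)
  ; single = single
  ; pair   = pair
  }
  where
  j′ = punchOut i≢j
  w′ = mergedWeight w i j′
  φ = removeTerm i (just (c , j′))

  ring₁ : ∀ x y c f z t → x + y + c * (f * (z + t)) ≡ x + c * (f * z) + (y + c * (f * t))
  ring₁ = solve-∀

  ring₂ : ∀ d x c f z → d * x + c * (f * (d * z)) ≡ d * (x + c * (f * z))
  ring₂ = solve-∀

  inv : ∀ {k s l} → φ k ≡ just (s , l) →
    (s ≡ Sign.+ × k ≡ punchIn i l) ⊎ (k ≡ i × just (c , j′) ≡ just (s , l))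
  inv = removeTerm-inv i (just (c , j′))

  light : ∀ l → w (punchIn i l) ≤ w′ l
  light l = ℕ.m≤m+n _ _

  heavy : w (punchIn i j′) ℕ.+ w i ≤ w′ j′
  heavy with j′ ≟ j′
  ... | yes _ = ℕ.≤-refl
  ... | no j′≢j′ = contradiction refl j′≢j′

  single : ∀ {k s l} → φ k ≡ just (s , l) → w k ≤ w′ l
  single φk with inv φk
  ... | inj₁ (_ , refl) = light _
  ... | inj₂ (refl , refl) = ℕ.≤-trans (ℕ.m≤n+m _ _) heavy

  pair : ∀ {k k′ s t l} → k ≢ k′ → φ k ≡ just (s , l) → φ k′ ≡ just (t , l) → w k ℕ.+ w k′ ≤ w′ l
  pair k≢k′ φk φk′ with inv φk | inv φk′
  ... | inj₁ (_ , refl) | inj₁ (_ , refl) = contradiction refl k≢k′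
  ... | inj₁ (_ , refl) | inj₂ (refl , refl) = heavy
  ... | inj₂ (refl , refl) | inj₁ (_ , refl) = ℕ.≤-trans (ℕ.≤-reflexive (ℕ.+-comm (w i) _)) heavy
  ... | inj₂ (refl , _) | inj₂ (refl , _) = contradiction refl k≢k′

  T-e : ∀ k l → e k (punchIn i l) + σ c * (e j (punchIn i l) * e k i) ≡ ⟦ φ k ⟧ l
  T-e k l with i ≟ k
  ... | yes refl rewrite e-off (punchInᵢ≢i i l ∘ sym) | e-at i | e-punch i≢j l = ring (σ c) (e j′ l)
    where
    ring : ∀ c z → 0ℤ + c * (z * 1ℤ) ≡ c * z
    ring = solve-∀
  ... | no i≢k rewrite e-off (i≢k ∘ sym) | e-punch i≢k l = ring (σ c) (e j (punchIn i l)) (e (punchOut i≢k) l)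
    where
    ring : ∀ c f z → z + c * (f * 0ℤ) ≡ 1ℤ * z
    ring = solve-∀

-- Contracting an edge therefore leaves the bound on the exponent unchanged.
mergedWeight-sum : ∀ {n} (w : Weight (suc n)) i j → ∑ℕ (mergedWeight w i j) ≡ ∑ℕ w
mergedWeight-sum w i j = begin
  ∑ℕ (mergedWeight w i j)          ≡⟨ Σℕ.∑-distrib-+ (w ∘ punchIn i) δ ⟩
  ∑ℕ (w ∘ punchIn i) ℕ.+ ∑ℕ δ      ≡⟨ cong (∑ℕ (w ∘ punchIn i) ℕ.+_) δ-sum ⟩
  ∑ℕ (w ∘ punchIn i) ℕ.+ w i       ≡⟨ ℕ.+-comm _ (w i) ⟩
  w i ℕ.+ ∑ℕ (w ∘ punchIn i)       ≡⟨ Σℕ.sum-remove w ⟨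
  ∑ℕ w                             ∎
  where
  open ≡-Reasoning
  δ : Weight _
  δ l = if does (j ≟ l) then w i else 0

  δ-at : δ j ≡ w i
  δ-at with j ≟ j
  ... | yes _ = refl
  ... | no j≢j = contradiction refl j≢j

  δ-off : ∀ l → l ≢ j → δ l ≡ 0
  δ-off l l≢j with j ≟ l
  ... | yes j≡l = contradiction (sym j≡l) l≢j
  ... | no _ = refl

  δ-sum : ∑ℕ δ ≡ w i
  δ-sum = trans (sum-single ℕ.+-0-commutativeMonoid δ j δ-off) δ-at

-- Induction on the size of the matrix

det-scaled-row : ∀ {n} (M : Matrix (suc n) (suc n)) i d → (∀ l → M zero l ≡ d * e i l) →
  det M ≡ -1ℤ ^ toℕ i * (d * det (minor M i))
det-scaled-row M i d M₀ = trans
  (det-expand-single M i λ l l≢i → trans (M₀ l) (trans (cong (d *_) (e-off (l≢i ∘ sym))) (*-zeroʳ d)))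
  (trans (cong (λ x → -1ℤ ^ toℕ i * x * det (minor M i)) (trans (M₀ i) (trans (cong (d *_) (e-at i)) (*-identityʳ d))))
    (*-assoc (-1ℤ ^ toℕ i) d _))

-- Every case passes to a minor whose rows stay admissible by `transport-row`. Deleting column `i`
-- frees weight `w i`, which can pay for a factor 2; merging keeps the total.
det-value : ∀ {n} (w : Weight n) (M : Matrix n n) → (∀ a → Row w (M a)) → Value (∑ℕ w) (det M)
det-value {zero} w M rows = value-one 0
det-value {suc n} w M rows = go (rows zero)
  where
  scaled : ∀ i d → (∀ l → M zero l ≡ d * e i l) →
    (Value (∑ℕ (w ∘ punchIn i)) (det (minor M i)) → Value (∑ℕ w) (d * det (minor M i))) →
    Value (∑ℕ w) (det M)
  scaled i d M₀ f = subst (Value (∑ℕ w)) (sym (det-scaled-row M i d M₀))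
    (value-power (toℕ i) (d * det (minor M i)) (f
      (det-value (w ∘ punchIn i) (minor M i) λ a → transport-row (delete-transport w i) (rows (suc a)))))

  deleted : ∀ i {z} → Value (∑ℕ (w ∘ punchIn i)) z → Value (w i ℕ.+ ∑ℕ (w ∘ punchIn i)) z
  deleted i = value-mono (ℕ.m≤n+m _ (w i))

  restore : ∀ i {z} → Value (w i ℕ.+ ∑ℕ (w ∘ punchIn i)) z → Value (∑ℕ w) z
  restore i {z} = subst (λ N → Value N z) (sym (Σℕ.sum-remove w))

  zero-row : (∀ l → M zero l ≡ 0ℤ) → Value (∑ℕ w) (det M)
  zero-row M₀ = inj₁ (sym (sum-zero +-0-commutativeMonoid λ l → cofactorTerm-zeroˡ M l (M₀ l)))

  unit-row : ∀ s i → (∀ l → M zero l ≡ σ s * e i l) → Value (∑ℕ w) (det M)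
  unit-row s i M₀ = scaled i (σ s) M₀ λ v → value-sign s _ (restore i (deleted i v))

  -- The deleted column takes weight at least 2 with it, which is the price in `value-double`.
  double-row : ∀ s i → 2 ≤ w i → (∀ l → M zero l ≡ σ s * e i l + σ s * e i l) → Value (∑ℕ w) (det M)
  double-row s i 2≤wᵢ M₀ = scaled i (σ s * (ℤ.+ 2)) (λ l → trans (M₀ l) (ring (σ s) (e i l))) λ v →
    subst (Value (∑ℕ w)) (sym (*-assoc (σ s) (ℤ.+ 2) _))
      (value-sign s _ (restore i (value-mono (ℕ.+-monoˡ-≤ _ 2≤wᵢ) (value-double _ v))))
    where
    ring : ∀ s x → s * x + s * x ≡ s * (ℤ.+ 2) * x
    ring = solve-∀

  edge-row : ∀ s i t j (i≢j : i ≢ j) → (s ≡ t → Positive w) →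
    (∀ l → M zero l ≡ σ s * e i l + σ t * e j l) → Value (∑ℕ w) (det M)
  edge-row s i t j i≢j w>0 M₀ = subst (Value (∑ℕ w))
    (trans (sym (det-scaled-row M′ i (σ s) M′₀)) (det-column-op M (σ c) i≢j))
    (value-power (toℕ i) (σ s * det (minor M′ i)) (value-sign s _
      (subst (λ N → Value N (det (minor M′ i))) (mergedWeight-sum w i (punchOut i≢j))
        (det-value (mergedWeight w i (punchOut i≢j)) (minor M′ i) λ a →
          transport-row (merge-transport w c i≢j (w>0 ∘ equal s t)) (rows (suc a))))))
    where
    -- This makes `σ t + σ c * σ s` zero, so entry `j` of the first row is cleared. Moreover `c` is
    -- `Sign.-` only if `s ≡ t`, and then `Compatible` provides the positivity that merging
    -- requires.
    c = Sign.opposite (s Sign.* t)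
    M′ : Matrix (suc n) (suc n)
    M′ a l = M a l + σ c * (e j l * M a i)

    equal : ∀ s t → Sign.opposite (s Sign.* t) ≡ Sign.- → s ≡ t
    equal Sign.+ Sign.+ _ = refl
    equal Sign.- Sign.- _ = refl

    cancel : ∀ s t x y → σ s * x + σ t * y + σ (Sign.opposite (s Sign.* t)) * (y * (σ s * 1ℤ + σ t * 0ℤ)) ≡ σ s * x
    cancel Sign.+ Sign.+ = solve-∀
    cancel Sign.+ Sign.- = solve-∀
    cancel Sign.- Sign.+ = solve-∀
    cancel Sign.- Sign.- = solve-∀

    M′₀ : ∀ l → M′ zero l ≡ σ s * e i l
    M′₀ l rewrite M₀ l | M₀ i | e-at i | e-off {i = j} {i} (i≢j ∘ sym) = cancel s t (e i l) (e j l)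

  go : Row w (M zero) → Value (∑ℕ w) (det M)
  go (row nothing nothing v≗ comp) = zero-row v≗
  go (row (just (s , i)) nothing v≗ comp) = unit-row s i λ l → trans (v≗ l) (+-identityʳ _)
  go (row nothing (just (t , j)) v≗ comp) = unit-row t j λ l → trans (v≗ l) (+-identityˡ _)
  go (row (just (s , i)) (just (t , j)) v≗ comp) with i ≟ j
  ... | no i≢j = edge-row s i t j i≢j (λ { refl → proj₁ (comp refl refl) }) v≗
  ... | yes refl with s Sign.≟ t
  ...   | yes refl = double-row s i (proj₂ (comp refl refl) refl) v≗
  ...   | no s≢t = zero-row λ l → trans (v≗ l) (cancel s t s≢t (e i l))
    where
    cancel : ∀ s t → s ≢ t → ∀ x → σ s * x + σ t * x ≡ 0ℤ
    cancel Sign.+ Sign.+ s≢t = contradiction refl s≢t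
    cancel Sign.- Sign.- s≢t = contradiction refl s≢t
    cancel Sign.+ Sign.- _ = solve-∀
    cancel Sign.- Sign.+ _ = solve-∀

-- Minors of the root systems

constWeight-mono : ∀ q {m n} → m ≤ n → ∑ℕ {m} (const q) ≤ ∑ℕ {n} (const q)
constWeight-mono q ℕ.z≤n = ℕ.z≤n
constWeight-mono q (ℕ.s≤s m≤n) = ℕ.+-monoʳ-≤ q (constWeight-mono q m≤n)

-- If no column is repeated, `c` is injective, so the minor has at most `n` columns and its total
-- weight is at most that of all `n` columns.
minor-value : ∀ {n} (U : List (Vector ℤ n)) q → (∀ {v} → v ∈ U → Row (const q) v) →
  ∀ {x} → Min U x → Value (∑ℕ {n} (const q)) x
minor-value {n} U q rows (k , r , c , refl)
  with any? (λ a → any? λ b → ¬? (a ≟ b) ×-dec (c a ≟ c b))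
... | yes (a , b , a≢b , ca≡cb) =
  inj₁ (sym (det-equal-columns (submatrix M[ U ] r c) a≢b λ i → cong (lookup U (r i)) ca≡cb))
... | no ∄ = value-mono (constWeight-mono q (injective⇒≤ c-inj))
  (det-value (const q) (submatrix M[ U ] r c) λ a →
    transport-row (restrict-transport c c-inj q) (rows (∈-lookup (r a))))
  where
  c-inj : ∀ {a b} → c a ≡ c b → a ≡ b
  c-inj {a} {b} eq = decidable-stable (a ≟ b) λ a≢b → ∄ (a , b , a≢b , eq)

row-minus : ∀ {n} (w : Weight n) i j → Row w (e i -ᵥ e j)
row-minus w i j = row (just (Sign.+ , i)) (just (Sign.- , j)) (λ l → ring (e i l) (e j l)) λ { refl () }
  where
  ring : ∀ x y → x ℤ.- y ≡ 1ℤ * x + -1ℤ * y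
  ring = solve-∀

row-plus : ∀ {n} (w : Weight n) i j → i ≢ j → Positive w → Row w (e i +ᵥ e j)
row-plus w i j i≢j w>0 = row (just (Sign.+ , i)) (just (Sign.+ , j)) (λ l → ring (e i l) (e j l))
  λ { refl refl → w>0 , λ i≡j → contradiction i≡j i≢j }
  where
  ring : ∀ x y → x + y ≡ 1ℤ * x + 1ℤ * y
  ring = solve-∀

row-e : ∀ {n} (w : Weight n) i → Row w (e i)
row-e w i = row (just (Sign.+ , i)) nothing (λ l → ring (e i l)) λ { refl () }
  where
  ring : ∀ x → x ≡ 1ℤ * x + 0ℤ
  ring = solve-∀

pairs-distinct : ∀ {n} {i j : Fin n} → (i , j) ∈ pairs n → i ≢ j
pairs-distinct {n} p refl =
  ℕ.<-irrefl refl (proj₂ (∈-filter⁻ (λ (i , j) → i <? j) {xs = cartesianProduct (allFin n) (allFin n)} p))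

pairs-complete : ∀ {n} {i j : Fin n} → i Fin.< j → (i , j) ∈ pairs n
pairs-complete i<j = ∈-filter⁺ (λ (i , j) → i <? j) (∈-cartesianProduct⁺ (∈-allFin _) (∈-allFin _)) i<j

rows-A : ∀ {n} {w : Weight n} {v} → v ∈ Φ⁺A n → Row w v
rows-A {n} {w} v∈ with (i , j) , _ , refl ← ∈-map⁻ (λ (i , j) → e i -ᵥ e j) v∈ = row-minus w i j

rows-B : ∀ {n} {w : Weight n} → Positive w → ∀ {v} → v ∈ Φ⁺B n → Row w v
rows-B {n} {w} w>0 v∈ with ∈-++⁻ (map (λ (i , j) → e i -ᵥ e j) (pairs n)) v∈
... | inj₁ v∈A = rows-A v∈A
... | inj₂ v∈′ with ∈-++⁻ (map (λ (i , j) → e i +ᵥ e j) (pairs n)) v∈′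
...   | inj₁ v∈+ with (i , j) , p , refl ← ∈-map⁻ (λ (i , j) → e i +ᵥ e j) v∈+ =
  row-plus w i j (pairs-distinct p) w>0
...   | inj₂ v∈e with i , _ , refl ← ∈-map⁻ e v∈e = row-e w i

-- With weight 0 on every column the total is 0, which leaves only the exponent 0.
A-value : ∀ {n x} → Min (Φ⁺A n) x → Value 0 x
A-value {n} {x} minor∈ = subst (λ N → Value N x) (sum-zero ℕ.+-0-commutativeMonoid {n} λ _ → refl)
  (minor-value (Φ⁺A n) 0 rows-A minor∈)

-- Weight 1 on every column admits the rows `e i +ᵥ e j` and has total `n`.
B-value : ∀ {n x} → Min (Φ⁺B n) x → Value n x
B-value {n} {x} minor∈ = subst (λ N → Value N x) (ones n)
  (minor-value (Φ⁺B n) 1 (rows-B λ _ → ℕ.≤-refl) minor∈)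
  where
  ones : ∀ n → ∑ℕ {n} (const 1) ≡ n
  ones zero = refl
  ones (suc n) = cong suc (ones n)

-- Realising the values as minors

min-intro : ∀ {n} {U : List (Vector ℤ n)} {k} (R : Matrix (suc k) n) (c : Fin (suc k) → Fin n) →
  (∀ a → R a ∈ U) → Min U (det (submatrix R id c))
min-intro {U = U} {k} R c R∈U = k , (λ a → index (R∈U a)) , c ,
  det-cong λ a l → cong (λ v → v (c l)) (lookup-index (R∈U a))

A⊆B : ∀ {n x} → Min (Φ⁺A n) x → Min (Φ⁺B n) x
A⊆B {n} (k , r , c , refl) = min-intro {U = Φ⁺B n} (M[ Φ⁺A n ] ∘ r) c λ a → ∈-++⁺ˡ (∈-lookup {xs = Φ⁺A n} (r a))

zero-minor : ∀ {n} {U : List (Vector ℤ n)} {v} → v ∈ U → Fin n → Min U 0ℤ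
zero-minor {U = U} {v} v∈U i = subst (Min U) (det-equal-columns N {zero} {suc zero} (λ ()) λ _ → refl)
  (min-intro {k = 1} (λ _ → v) (const i) λ _ → v∈U)
  where
  N : Matrix 2 2
  N _ _ = v i

root-A : ∀ {n} {i j : Fin n} → i Fin.< j → e i -ᵥ e j ∈ Φ⁺A n
root-A i<j = ∈-map⁺ (λ (i , j) → e i -ᵥ e j) (pairs-complete i<j)

root-B⁺ : ∀ {n} {i j : Fin n} → i Fin.< j → e i +ᵥ e j ∈ Φ⁺B n
root-B⁺ {n} i<j = ∈-++⁺ʳ (map (λ (i , j) → e i -ᵥ e j) (pairs n))
  (∈-++⁺ˡ (∈-map⁺ (λ (i , j) → e i +ᵥ e j) (pairs-complete i<j)))

A-realise : ∀ {n} → Value 0 ⊆ Min (Φ⁺A (2 ℕ.+ n))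
A-realise {n} = λ
  { (inj₁ refl) → zero-minor root zero
  -- 1 and -1 are the two nonzero entries of the root e₁ - e₂.
  ; (inj₂ (zero , _ , inj₁ refl)) → min-intro {k = 0} (λ _ → e zero -ᵥ e (suc zero)) (const zero) (const root)
  ; (inj₂ (zero , _ , inj₂ refl)) → min-intro {k = 0} (λ _ → e zero -ᵥ e (suc zero)) (const (suc zero)) (const root)
  }
  where
  root : e zero -ᵥ e (suc zero) ∈ Φ⁺A (2 ℕ.+ n)
  root = root-A ℕ.z<s

edge : ∀ {n} → Sign × Fin n × Fin n → Vector ℤ n
edge (Sign.+ , i , j) = e i +ᵥ e j
edge (Sign.- , i , j) = e i -ᵥ e j

shift : ∀ {n} → Sign × Fin n × Fin n → Sign × Fin (2 ℕ.+ n) × Fin (2 ℕ.+ n)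
shift (s , i , j) = s , suc (suc i) , suc (suc j)

-- The first two rows of a block are e₀ ± e₁ on its own pair of columns; s is
-- the sign in the very first row, and decides the sign of the determinant.
blockRow : ∀ {n} k → k ≤ ⌊ n /2⌋ → Sign → Fin (k ℕ.* 2) → Sign × Fin n × Fin n
blockRow {suc (suc n)} (suc k) _ s zero = s , zero , suc zero
blockRow {suc (suc n)} (suc k) _ s (suc zero) = Sign.opposite s , zero , suc zero
blockRow {suc (suc n)} (suc k) (ℕ.s≤s k≤) s (suc (suc a)) = shift (blockRow k k≤ Sign.- a)

blockColumn : ∀ {n} k → k ≤ ⌊ n /2⌋ → Fin (k ℕ.* 2) → Fin n
blockColumn {suc (suc n)} (suc k) _ zero = zero
blockColumn {suc (suc n)} (suc k) _ (suc zero) = suc zero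
blockColumn {suc (suc n)} (suc k) (ℕ.s≤s k≤) (suc (suc a)) = suc (suc (blockColumn k k≤ a))

blockMatrix : ∀ {n} k → k ≤ ⌊ n /2⌋ → Sign → Matrix (k ℕ.* 2) (k ℕ.* 2)
blockMatrix {n} k k≤ s a l = edge (blockRow {n} k k≤ s a) (blockColumn k k≤ l)

blockRow-∈ : ∀ {n} k (k≤ : k ≤ ⌊ n /2⌋) s a → edge (blockRow k k≤ s a) ∈ Φ⁺B n
blockRow-∈ {n} k k≤ s a = edge-∈ (blockRow k k≤ s a) (increasing k k≤ s a)
  where
  increasing : ∀ {n} k (k≤ : k ≤ ⌊ n /2⌋) s a → let (_ , i , j) = blockRow {n} k k≤ s a in i Fin.< j
  increasing {suc (suc n)} (suc k) _ s zero = ℕ.z<s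
  increasing {suc (suc n)} (suc k) _ s (suc zero) = ℕ.z<s
  increasing {suc (suc n)} (suc k) (ℕ.s≤s k≤) s (suc (suc a)) = ℕ.s<s (ℕ.s<s (increasing k k≤ Sign.- a))

  edge-∈ : ∀ x → let (_ , i , j) = x in i Fin.< j → edge x ∈ Φ⁺B n
  edge-∈ (Sign.+ , _) i<j = root-B⁺ i<j
  edge-∈ (Sign.- , _) i<j = ∈-++⁺ˡ (root-A i<j)

-- The top left block has rows (1 , s) and (1 , - s), hence determinant -2s. The zeros to its right
-- make the matrix block triangular.
det-block : ∀ {n} (M : Matrix (2 ℕ.+ n) (2 ℕ.+ n)) s →
  M zero zero ≡ 1ℤ → M zero (suc zero) ≡ s → (∀ l → M zero (suc (suc l)) ≡ 0ℤ) →
  M (suc zero) zero ≡ 1ℤ → M (suc zero) (suc zero) ≡ - s → (∀ l → M (suc zero) (suc (suc l)) ≡ 0ℤ) →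
  det M ≡ - s * ((ℤ.+ 2) * det (submatrix M (2 Fin.↑ʳ_) (2 Fin.↑ʳ_)))
det-block M s a b M₀ c d M₁ = begin
  det M
    ≡⟨ sum-pair +-0-commutativeMonoid (cofactorTerm M) {zero} {suc zero} (λ ()) off ⟩
  1ℤ * M zero zero * det (minor M zero) + -1ℤ * M zero (suc zero) * det (minor M (suc zero))
    ≡⟨ cong₂ _+_ (cong₂ (λ x y → 1ℤ * x * y) a left) (cong₂ (λ x y → -1ℤ * x * y) b right) ⟩
  1ℤ * 1ℤ * (1ℤ * - s * D) + -1ℤ * s * (1ℤ * 1ℤ * D)
    ≡⟨ ring s D ⟩
  - s * ((ℤ.+ 2) * D) ∎
  where
  open ≡-Reasoning
  D = det (submatrix M (2 Fin.↑ʳ_) (2 Fin.↑ʳ_))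

  off : ∀ l → l ≢ zero → l ≢ suc zero → cofactorTerm M l ≡ 0ℤ
  off zero l≢0 _ = contradiction refl l≢0
  off (suc zero) _ l≢1 = contradiction refl l≢1
  off (suc (suc l)) _ _ = cofactorTerm-zeroˡ M (suc (suc l)) (M₀ l)

  only : ∀ p → (∀ l → M (suc zero) (punchIn p (suc l)) ≡ 0ℤ) → ∀ l → l ≢ zero → minor M p zero l ≡ 0ℤ
  only p eq zero l≢0 = contradiction refl l≢0
  only p eq (suc l) _ = eq l

  left : det (minor M zero) ≡ 1ℤ * - s * D
  left = trans (det-expand-single (minor M zero) zero (only zero M₁)) (cong (λ x → 1ℤ * x * D) d)

  right : det (minor M (suc zero)) ≡ 1ℤ * 1ℤ * D
  right = trans (det-expand-single (minor M (suc zero)) zero (only (suc zero) M₁)) (cong (λ x → 1ℤ * x * D) c)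

  ring : ∀ s D → 1ℤ * 1ℤ * (1ℤ * - s * D) + -1ℤ * s * (1ℤ * 1ℤ * D) ≡ - s * ((ℤ.+ 2) * D)
  ring = solve-∀

edge-shift : ∀ {n} x l → edge {2 ℕ.+ n} (shift x) (suc (suc l)) ≡ edge x l
edge-shift (Sign.+ , i , j) l = refl
edge-shift (Sign.- , i , j) l = refl

-- Only the first block carries the sign `s`. All later blocks start with `Sign.-` and contribute 2
-- each, so the total sign is `- σ s`.
det-blockMatrix : ∀ {n} k (k≤ : suc k ≤ ⌊ n /2⌋) s →
  det (blockMatrix {n} (suc k) k≤ s) ≡ - σ s * ((ℤ.+ 2) ^ suc k)
det-blockMatrix {suc (suc n)} k (ℕ.s≤s k≤) s = trans (block s)
  (cong (λ D → - σ s * ((ℤ.+ 2) * D)) (trans (det-cong rest) (inner k k≤)))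
  where
  M = blockMatrix {suc (suc n)} (suc k) (ℕ.s≤s k≤)
  -- Splitting on the sign lets `edge` reduce, so that the entries compute.
  block : ∀ s → det (M s) ≡ - σ s * ((ℤ.+ 2) * det (submatrix (M s) (2 Fin.↑ʳ_) (2 Fin.↑ʳ_)))
  block Sign.+ = det-block (M Sign.+) 1ℤ refl refl (λ _ → refl) refl refl λ _ → refl
  block Sign.- = det-block (M Sign.-) -1ℤ refl refl (λ _ → refl) refl refl λ _ → refl

  rest : ∀ a → submatrix (M s) (2 Fin.↑ʳ_) (2 Fin.↑ʳ_) a ≗ blockMatrix k k≤ Sign.- a
  rest a l = edge-shift (blockRow k k≤ Sign.- a) (blockColumn k k≤ l)

  inner : ∀ k (k≤ : k ≤ ⌊ n /2⌋) → det (blockMatrix {n} k k≤ Sign.-) ≡ (ℤ.+ 2) ^ k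
  inner zero _ = refl
  inner (suc k) k≤ = trans (det-blockMatrix k k≤ Sign.-) (*-identityˡ _)

power-minor : ∀ {n} k (k≤ : suc k ≤ ⌊ n /2⌋) s → Min (Φ⁺B n) (- σ s * ((ℤ.+ 2) ^ suc k))
power-minor {n} k k≤ s = subst (Min (Φ⁺B n)) (det-blockMatrix k k≤ s)
  (min-intro (edge ∘ blockRow (suc k) k≤ s) (blockColumn (suc k) k≤) (blockRow-∈ (suc k) k≤ s))

-- Exponent 0 would give an empty block matrix, but minors are nonempty; ±1 is therefore taken from
-- type A, as is 0.
B-realise : ∀ {n} → Value (2 ℕ.+ n) ⊆ Min (Φ⁺B (2 ℕ.+ n))
B-realise (inj₁ eq) = A⊆B (A-realise (inj₁ eq))
B-realise (inj₂ (zero , _ , eq)) = A⊆B (A-realise (inj₂ (zero , ℕ.z≤n , eq)))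
B-realise {n} (inj₂ (suc k , k≤ , inj₁ refl)) =
  subst (Min (Φ⁺B (2 ℕ.+ n))) (*-identityˡ _) (power-minor k k≤ Sign.-)
B-realise {n} (inj₂ (suc k , k≤ , inj₂ refl)) =
  subst (Min (Φ⁺B (2 ℕ.+ n))) (-1*i≡-i _) (power-minor k k≤ Sign.+)

value-zero : Value 0 ≐ ｛ 0ℤ ｝ ∪ ｛ 1ℤ ｝ ∪ ｛ -1ℤ ｝
value-zero =
  (λ { (inj₁ eq) → inj₁ eq
     ; (inj₂ (zero , _ , inj₁ eq)) → inj₂ (inj₁ eq)
     ; (inj₂ (zero , _ , inj₂ eq)) → inj₂ (inj₂ eq) }) ,
  (λ { (inj₁ eq) → inj₁ eq
     ; (inj₂ (inj₁ eq)) → inj₂ (zero , ℕ.z≤n , inj₁ eq)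
     ; (inj₂ (inj₂ eq)) → inj₂ (zero , ℕ.z≤n , inj₂ eq) })

mainTheorem6 : (n : ℕ) → 2 ≤ n →
    (Min (Φ⁺A n) ≐ ｛ 0ℤ ｝ ∪ ｛ 1ℤ ｝ ∪ ｛ -1ℤ ｝)
    × (Min (Φ⁺B n) ≐ ｛ 0ℤ ｝ ∪ ±2^≤ ⌊ n /2⌋)
mainTheorem6 (suc (suc n)) (ℕ.s≤s (ℕ.s≤s ℕ.z≤n)) =
  ((λ x∈ → proj₁ value-zero (A-value x∈)) , (λ x∈ → A-realise (proj₂ value-zero x∈))) ,
  (B-value , B-realise)
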